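{- Let $m\geq 3$, $n\geq 3$ and $x$ be positive integers such that both $m$ and $n$ divide $3x$, and let $h,u$ be positive integers. Suppose the following conditions are satisfied: (i) there exists a $3$-RGDD$(h^u)$; (ii) for each $p\in\{1,2,\ldots,\frac{h(u-1)}{2}\}$, there exists a decomposition of $K_{(x:3)}$ into $r_p$ $C_m$-factors and $s_p$ $C_n$-factors; (iii) there exists an $(m,n)\text{ - }\mathrm{HWP}(hx;r_\beta,s_\beta)$. Let $$r_\alpha=\sum_{p=1}^{\frac{h(u-1)}{2}} r_p\quad\text{and}\quad s_\alpha=\sum_{p=1}^{\frac{h(u-1)}{2}} s_p.$$ Then there exists an $(m,n)\text{ - }\mathrm{HWP}(hux;r_\alpha+r_\beta,s_\alpha+s_\beta)$.
   Context: A $C_m$-factor of a graph $G$ is a spanning subgraph of $G$ all of whose connected components are cycles of length $m$. A decomposition of a graph is a partition of its edge set into (edge sets of) subgraphs. For integers $m,n\ge 3$, $v\geq 1$ and $r,s\geq 0$, an $(m,n)\text{ - }\mathrm{HWP}(v;r,s)$ is a decomposition of the complete graph $K_v$ if $v$ is odd, or of $K_v-F$ for some $1$-factor (perfect matching) $F$ of $K_v$ if $v$ is even, into $r$ $C_m$-factors and $s$ $C_n$-factors. $K_{(h:u)}$ denotes the complete multipartite graph with $u$ parts of size $h$. A $3$-RGDD$(h^u)$ (resolvable group divisible design with block size $3$ and index $1$) is a triple $(\mathcal{V},\mathcal{G},\mathcal{B})$ where $\mathcal{V}$ is a set of size $hu$, $\mathcal{G}$ is a partition of $\mathcal{V}$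 into $u>1$ subsets (called groups) of size $h$, and $\mathcal{B}$ is a collection of $3$-element subsets of $\mathcal{V}$ (called blocks) such that no two distinct elements of the same group lie together in a block, any two elements from different groups lie together in exactly one block, and $\mathcal{B}$ can be partitioned into parallel classes, each element of $\mathcal{V}$ lying in exactly one block of each parallel class. (Such a design has $\frac{h(u-1)}{2}$ parallel classes.) -}

module Defs where

open import Level using (0ℓ)
open import Data.Nat.Base using (ℕ; suc; _+_; _*_; _<_)
open import Data.Nat.Divisibility using (_∣_)
open import Data.Fin.Base using (Fin; toℕ)
open import Data.Fin.Subset using (Subset; _∈_; ∣_∣)
open import Data.Product using (_×_; _,_; ∃; ∃!; proj₁)
open import Data.Sum.Base using (_⊎_; inj₁; inj₂)
open import Function.Base using (_∘_)
open import Function.Bundles using (_⇔_)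
open import Function.Definitions using (Injective)
open import Relation.Binary.Core using (Rel)
open import Relation.Binary.Definitions using (Symmetric)
open import Relation.Binary.Construct.Closure.ReflexiveTransitive using (Star)
open import Relation.Binary.PropositionalEquality using (_≡_; _≢_; sym; refl)
open import Relation.Nullary.Negation using (¬_)

record Graph (V : Set) : Set₁ where
  field
    Adj    : Rel V 0ℓ
    symm   : Symmetric Adj
    irrefl : ∀ {a} → ¬ Adj a a

open Graph public

-- H is a spanning subgraph of G: both have the whole of V as vertex set.
_⊑_ : ∀ {V} → Graph V → Graph V → Set
H ⊑ G = ∀ {a b} → Adj H a b → Adj G a b

complete : ∀ v → Graph (Fin v)
complete v = record
  { Adj    = _≢_
  ; symm   = _∘ sym
  ; irrefl = λ a≢a → a≢a refl
  }

-- K_{(h:u)}: u parts of size h; the first component of a vertex is its part.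
completeMultipartite : ∀ h u → Graph (Fin u × Fin h)
completeMultipartite h u = record
  { Adj    = λ a b → proj₁ a ≢ proj₁ b
  ; symm   = _∘ sym
  ; irrefl = λ a≢a → a≢a refl
  }

_−_ : ∀ {V} → Graph V → Graph V → Graph V
G − F = record
  { Adj    = λ a b → Adj G a b × ¬ Adj F a b
  ; symm   = λ (g , ¬f) → symm G g , ¬f ∘ symm F
  ; irrefl = λ (g , _) → irrefl G g
  }

IsOneFactor : ∀ {V} → Graph V → Graph V → Set
IsOneFactor G F = F ⊑ G × (∀ a → ∃! _≡_ λ b → Adj F a b)

CyclicSuc : ∀ {m} → Rel (Fin m) 0ℓ
CyclicSuc {m} i j = suc (toℕ i) ≡ toℕ j ⊎ (suc (toℕ i) ≡ m × toℕ j ≡ 0)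

-- Adjacency in the cycle C_m with vertices 0, …, m-1, for m ≥ 3.
CycleAdj : ∀ {m} → Rel (Fin m) 0ℓ
CycleAdj i j = CyclicSuc i j ⊎ CyclicSuc j i

-- The connected component of F containing a (the subgraph induced on the
-- vertices reachable from a) is isomorphic to C_m.
record ComponentIsCycle {V : Set} (m : ℕ) (F : Graph V) (a : V) : Set where
  field
    vertex    : Fin m → V
    injective : Injective _≡_ _≡_ vertex
    component : ∀ b → Star (Adj F) a b ⇔ (∃ λ i → vertex i ≡ b)
    adjacency : ∀ i j → Adj F (vertex i) (vertex j) ⇔ CycleAdj i j

IsCycleFactor : ∀ {V} → ℕ → Graph V → Graph V → Set
IsCycleFactor m G F = F ⊑ G × (∀ a → ComponentIsCycle m F a)

IsDecomposition : ∀ {V I : Set} → Graph V → (I → Graph V) → Set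
IsDecomposition G H =
  (∀ i → H i ⊑ G) × (∀ {a b} → Adj G a b → ∃! _≡_ λ i → Adj (H i) a b)

record CycleFactorDecomposition {V : Set} (G : Graph V) (m n r s : ℕ) : Set₁ where
  field
    factor          : Fin r ⊎ Fin s → Graph V
    isDecomposition : IsDecomposition G factor
    isCₘ-factor     : ∀ i → IsCycleFactor m G (factor (inj₁ i))
    isCₙ-factor     : ∀ j → IsCycleFactor n G (factor (inj₂ j))

-- (m,n)-HWP(v;r,s), for m, n ≥ 3 and v ≥ 1.
HWP : (m n v r s : ℕ) → Set₁
HWP m n v r s =
    (¬ 2 ∣ v × CycleFactorDecomposition (complete v) m n r s)
  ⊎ (2 ∣ v × ∃ λ F → IsOneFactor (complete v) F
                   × CycleFactorDecomposition (complete v − F) m n r s)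

-- 3-RGDD(h^u).  Blocks are an indexed family; it has no repetitions, since each
-- block contains two points of different groups and these lie in only one block.
-- The number of parallel classes is not prescribed.
record 3-RGDD (h u : ℕ) : Set where
  field
    1<u             : 1 < u
    group           : Fin u → Subset (h * u)
    group-size      : ∀ g → ∣ group g ∣ ≡ h
    group-partition : ∀ a → ∃! _≡_ λ g → a ∈ group g

    #blocks         : ℕ
    block           : Fin #blocks → Subset (h * u)
    block-size      : ∀ B → ∣ block B ∣ ≡ 3
    same-group      : ∀ {g a b} → a ≢ b → a ∈ group g → b ∈ group g →
                      ∀ B → ¬ (a ∈ block B × b ∈ block B)
    different-group : ∀ {g g′ a b} → g ≢ g′ → a ∈ group g → b ∈ group g′ →
                      ∃! _≡_ λ B → a ∈ block B × b ∈ block B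

    #classes        : ℕ
    class           : Fin #blocks → Fin #classes
    parallel        : ∀ P a → ∃! _≡_ λ B → class B ≡ P × a ∈ block B

{-# OPTIONS --safe #-}

-- Weighting: every point of the 3-RGDD is inflated to x vertices.  The groups,
-- and likewise the blocks of each parallel class, then tile the vertex set.
-- Placing a copy of one and the same cycle factor on every tile gives a cycle
-- factor of the whole graph, and the edges inside groups together with the edges
-- across the blocks of each class partition all edges.  Counting the points by the
-- block that joins them to a fixed point gives h + 2c = hu for the number c of
-- classes; so c = h(u-1)/2, and hx and hux have the same parity.

module Submission where

open import Data.Nat using (ℕ; _+_; _*_; _∸_; _/_; _≤_)
open import Data.Nat.Divisibility using (_∣_)
open import Data.Nat.Properties using (+-*-semiring)
open import Algebra.Properties.Semiring.Sum +-*-semiring using (sum)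
open import Data.Fin using (Fin)
open import Defs

open import Data.Bool.Base using (true; false)
open import Data.Nat.Base using (zero; suc)
open import Data.Nat.Divisibility using (∣m∣n⇒∣m+n; ∣m+n∣m⇒∣n; ∣m⇒∣m*n; n∣m*n)
open import Data.Nat.DivMod using (m*n/n≡m)
open import Data.Nat.Properties
  using (suc-injective; +-comm; *-distribʳ-+; *-distribˡ-∸; *-identityʳ; m+n∸m≡n)
open import Data.Fin.Base using (zero; suc; punchIn; punchOut)
open import Data.Fin.Patterns using (0F)
open import Data.Fin.Permutation using (↔⇒≡)
open import Data.Fin.Properties
  using (_≟_; +↔⊎; *↔×; punchIn-injective; punchInᵢ≢i; punchIn-punchOut)
  renaming (suc-injective to sucᶠ-injective)
open import Data.Fin.Subset using (Subset; _∈_; ∣_∣)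
open import Data.Product using (Σ; _×_; _,_; ∃; ∃!; proj₁; proj₂; map₂)
open import Data.Product.Properties using (,-injective)
open import Data.Sum.Base using (_⊎_; inj₁; inj₂)
open import Data.Sum.Function.Propositional using (_⊎-↔_)
open import Data.Vec.Base using ([]; _∷_; here; there)
import Data.Vec.Functional as Vector
open import Function.Base using (_∘_)
open import Function.Bundles using (_↔_; _⇔_; Inverse; Equivalence; mk⇔; mk↔ₛ′)
open import Function.Construct.Composition using (_↔-∘_; _⇔-∘_)
open import Function.Construct.Identity using (↔-id)
open import Function.Construct.Symmetry using (↔-sym)
open import Function.Definitions using (Injective)
open import Relation.Binary.Construct.Closure.ReflexiveTransitive using (Star; ε; _◅_; gmap)
open import Relation.Binary.PropositionalEquality
  using (_≡_; _≢_; refl; sym; trans; cong; cong₂; subst; subst₂; module ≡-Reasoning)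
open import Relation.Nullary.Decidable using (yes; no)
open import Relation.Nullary.Negation using (¬_; contradiction)

open Inverse using (to; from; strictlyInverseˡ; strictlyInverseʳ)

-- Partitions into tiles with coordinates

to-injective : ∀ {A B : Set} (e : A ↔ B) → Injective _≡_ _≡_ (to e)
to-injective e {a} {b} eq =
  trans (sym (strictlyInverseʳ e a)) (trans (cong (from e) eq) (strictlyInverseʳ e b))

-- By its type `rank` may depend on the membership proof; `at-rank` and `at-injective` together rule
-- this out.
record Enumeration {n : ℕ} (S : Subset n) (k : ℕ) : Set where
  field
    at           : Fin k → Fin n
    at-∈         : ∀ i → at i ∈ S
    at-injective : Injective _≡_ _≡_ at
    rank         : ∀ {a} → a ∈ S → Fin k
    at-rank      : ∀ {a} (a∈S : a ∈ S) → at (rank a∈S) ≡ a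

enumerate : ∀ {n k} (S : Subset n) → ∣ S ∣ ≡ k → Enumeration S k
enumerate [] refl = record
  { at = λ () ; at-∈ = λ () ; at-injective = λ { {()} } ; rank = λ () ; at-rank = λ () }
enumerate (false ∷ S) eq = record
  { at           = suc ∘ at
  ; at-∈         = there ∘ at-∈
  ; at-injective = at-injective ∘ sucᶠ-injective
  ; rank         = λ { (there a∈S) → rank a∈S }
  ; at-rank      = λ { (there a∈S) → cong suc (at-rank a∈S) }
  }
  where open Enumeration (enumerate S eq)
enumerate {k = suc k} (true ∷ S) eq = record
  { at           = λ { zero → zero ; (suc i) → suc (at i) }
  ; at-∈         = λ { zero → here ; (suc i) → there (at-∈ i) }
  ; at-injective = λ { {zero} {zero} _ → refl
                     ; {suc i} {suc j} p → cong suc (at-injective (sucᶠ-injective p)) }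
  ; rank         = λ { here → zero ; (there a∈S) → suc (rank a∈S) }
  ; at-rank      = λ { here → refl ; (there a∈S) → cong suc (at-rank a∈S) }
  }
  where open Enumeration (enumerate S (suc-injective eq))

-- A partition of V into tiles, each identified with W by coord; point a w is the
-- vertex with coordinate w in the tile of a.  Not every label in K need occur.
record Tiling (V K W : Set) : Set where
  field
    tile        : V → K
    coord       : V → W
    point       : V → W → V
    tile-point  : ∀ a w → tile (point a w) ≡ tile a
    coord-point : ∀ a w → coord (point a w) ≡ w
    separated   : ∀ {a b} → tile a ≡ tile b → coord a ≡ coord b → a ≡ b

  point-coord : ∀ {a b} → tile a ≡ tile b → point a (coord b) ≡ b
  point-coord {a} {b} eq = separated (trans (tile-point a _) eq) (coord-point a _)

open Tiling

-- The last hypothesis concerns only the sets `S (f a)`, so the sets `S κ` at large may overlap.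
-- Hence the family of all blocks can serve each parallel class.
subsetTiling : ∀ {n k} {K : Set} (S : K → Subset n) → (∀ κ → ∣ S κ ∣ ≡ k) →
  (f : Fin n → K) → (∀ a → a ∈ S (f a)) → (∀ {a b} → b ∈ S (f a) → f b ≡ f a) →
  Tiling (Fin n) K (Fin k)
subsetTiling S size f ∈S unique = record
  { tile        = f
  ; coord       = λ a → rank (E (f a)) (∈S a)
  ; point       = λ a → at (E (f a))
  ; tile-point  = λ a w → unique (at-∈ (E (f a)) w)
  ; coord-point = λ a w → rank-at (unique (at-∈ (E (f a)) w)) (∈S (at (E (f a)) w)) refl
  ; separated   = λ {a} {b} p q →
      rank-injective p (∈S a) (∈S b) q
  }
  where
  open Enumeration
  E = λ κ → enumerate (S κ) (size κ)

  -- Labels of points in a common tile are equal only propositionally. Taking that equation as an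
  -- argument to match with `refl` spares transporting membership proofs.
  rank-at : ∀ {κ κ′ a i} → κ ≡ κ′ → (a∈ : a ∈ S κ) → a ≡ at (E κ′) i → rank (E κ) a∈ ≡ i
  rank-at {κ} refl a∈ eq = at-injective (E κ) (trans (at-rank (E κ) a∈) eq)

  rank-injective : ∀ {κ κ′ a b} → κ ≡ κ′ → (a∈ : a ∈ S κ) (b∈ : b ∈ S κ′) →
    rank (E κ) a∈ ≡ rank (E κ′) b∈ → a ≡ b
  rank-injective {κ} refl a∈ b∈ eq =
    trans (sym (at-rank (E κ) a∈)) (trans (cong (at (E κ)) eq) (at-rank (E κ) b∈))

-- The bijection into `W′` chooses the form of the new coordinates: groups need a single
-- `Fin (h * x)` to carry a complete graph, blocks need pairs to carry a multipartite one.
inflate : ∀ {V V′ K W W′ X : Set} → V′ ↔ (V × X) → (W × X) ↔ W′ →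
  Tiling V K W → Tiling V′ K W′
inflate e f T = record
  { tile        = tile T ∘ proj₁ ∘ to e
  ; coord       = λ a → to f (coord T (proj₁ (to e a)) , proj₂ (to e a))
  ; point       = point′
  ; tile-point  = λ a w → trans (cong (tile T ∘ proj₁) (to-point′ a w)) (tile-point T _ _)
  ; coord-point = λ a w → begin
      to f (coord T (proj₁ (to e (point′ a w))) , proj₂ (to e (point′ a w)))
        ≡⟨ cong (λ p → to f (coord T (proj₁ p) , proj₂ p)) (to-point′ a w) ⟩
      to f (coord T (point T (proj₁ (to e a)) (proj₁ (from f w))) , proj₂ (from f w))
        ≡⟨ cong (λ c → to f (c , proj₂ (from f w))) (coord-point T _ _) ⟩
      to f (from f w)
        ≡⟨ strictlyInverseˡ f w ⟩
      w ∎
  ; separated   = λ p q → let r , s = ,-injective (to-injective f q) in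
                  to-injective e (cong₂ _,_ (separated T p r) s)
  }
  where
  open ≡-Reasoning
  point′ = λ a w → from e (point T (proj₁ (to e a)) (proj₁ (from f w)) , proj₂ (from f w))
  to-point′ : ∀ a w →
    to e (point′ a w) ≡ (point T (proj₁ (to e a)) (proj₁ (from f w)) , proj₂ (from f w))
  to-point′ a w = strictlyInverseˡ e _

-- Copying a graph onto every tile

copies : ∀ {V K W} → Tiling V K W → Graph W → Graph V
copies T G = record
  { Adj    = λ a b → tile T a ≡ tile T b × Adj G (coord T a) (coord T b)
  ; symm   = λ (p , g) → sym p , symm G g
  ; irrefl = λ (_ , g) → irrefl G g
  }

module _ {V K W} (T : Tiling V K W) where

  copies-point : ∀ (G : Graph W) a {w w′} →
    Adj (copies T G) (point T a w) (point T a w′) ⇔ Adj G w w′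
  copies-point G a {w} {w′} = mk⇔
    (λ (_ , g) → subst₂ (Adj G) (coord-point T a w) (coord-point T a w′) g)
    (λ g → trans (tile-point T a w) (sym (tile-point T a w′)) ,
           subst₂ (Adj G) (sym (coord-point T a w)) (sym (coord-point T a w′)) g)

  copies-⊑ : ∀ {G H} → H ⊑ G → copies T H ⊑ copies T G
  copies-⊑ H⊑G = map₂ H⊑G

  -- No edge of `copies T F` leaves its tile, so walks from `a` project along `coord T` and lift
  -- back along `point T a`.
  copies-component : ∀ {m} {F : Graph W} {a} →
    ComponentIsCycle m F (coord T a) → ComponentIsCycle m (copies T F) a
  copies-component {F = F} {a} C = record
    { vertex    = point T a ∘ C.vertex
    ; injective = λ {i} {j} eq → C.injective
        (trans (sym (coord-point T a _)) (trans (cong (coord T) eq) (coord-point T a _)))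
    ; component = λ b → mk⇔
        (λ path → let i , eq = Equivalence.to (C.component (coord T b)) (gmap (coord T) proj₂ path)
                  in i , trans (cong (point T a) eq) (point-coord T (same-tile path)))
        -- The lifted walk starts at `point T a (coord T a)`, which is `a`.
        (λ (i , eq) → subst₂ (Star (Adj (copies T F))) (point-coord T refl) eq
          (gmap (point T a) (Equivalence.from (copies-point F a))
            (Equivalence.from (C.component (C.vertex i)) (i , refl))))
    ; adjacency = λ i j → C.adjacency i j ⇔-∘ copies-point F a
    }
    where
    module C = ComponentIsCycle C
    same-tile : ∀ {a b} → Star (Adj (copies T F)) a b → tile T a ≡ tile T b
    same-tile ε              = refl
    same-tile ((p , _) ◅ ps) = trans p (same-tile ps)

  copies-cycleFactor : ∀ {m G F} → IsCycleFactor m G F → IsCycleFactor m (copies T G) (copies T F)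
  copies-cycleFactor {G = G} {F} (F⊑G , C) =
    copies-⊑ {G} {F} F⊑G , λ a → copies-component (C (coord T a))

  copies-decomposition : ∀ {m n r s G} → CycleFactorDecomposition G m n r s →
    CycleFactorDecomposition (copies T G) m n r s
  copies-decomposition {G = G} D = record
    { factor          = copies T ∘ D.factor
    ; isDecomposition = (λ i → copies-⊑ {G} {D.factor i} (proj₁ D.isDecomposition i)) ,
        λ (p , g) → let i , f , unique = proj₂ D.isDecomposition g
                    in i , (p , f) , unique ∘ proj₂
    ; isCₘ-factor     = copies-cycleFactor {G = G} ∘ D.isCₘ-factor
    ; isCₙ-factor     = copies-cycleFactor {G = G} ∘ D.isCₙ-factor
    }
    where module D = CycleFactorDecomposition D

  copies-matching : ∀ (F : Graph W) → (∀ w → ∃! _≡_ (Adj F w)) → ∀ a → ∃! _≡_ (Adj (copies T F) a)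
  copies-matching F matched a =
    let w , f , unique = matched (coord T a) in
    point T a w ,
    (sym (tile-point T a w) , subst (Adj F (coord T a)) (sym (coord-point T a w)) f) ,
    λ (p , f′) → trans (cong (point T a) (unique f′)) (point-coord T p)

-- Reindexing and refining decompositions

Fin-sum : ∀ {c} (r : Fin c → ℕ) → Fin (sum r) ↔ Σ (Fin c) (Fin ∘ r)
Fin-sum {zero}  r = mk↔ₛ′ (λ ()) (λ ()) (λ ()) (λ ())
Fin-sum {suc c} r = mk↔ₛ′
  (λ { (inj₁ i) → zero , i ; (inj₂ (q , i)) → suc q , i })
  (λ { (zero , i) → inj₁ i ; (suc q , i) → inj₂ (q , i) })
  (λ { (zero , i) → refl ; (suc q , i) → refl })
  (λ { (inj₁ i) → refl ; (inj₂ (q , i)) → refl })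
  ↔-∘ ((↔-id _ ⊎-↔ Fin-sum (r ∘ suc)) ↔-∘ +↔⊎)

Σ-⊎ : ∀ {I : Set} {A B : I → Set} → (Σ I A ⊎ Σ I B) ↔ Σ I λ i → A i ⊎ B i
Σ-⊎ = mk↔ₛ′
  (λ { (inj₁ (i , a)) → i , inj₁ a ; (inj₂ (i , b)) → i , inj₂ b })
  (λ { (i , inj₁ a) → inj₁ (i , a) ; (i , inj₂ b) → inj₂ (i , b) })
  (λ { (i , inj₁ a) → refl ; (i , inj₂ b) → refl })
  (λ { (inj₁ _) → refl ; (inj₂ _) → refl })

module _ {V : Set} {G : Graph V} where

  reindex : ∀ {I J : Set} {H : I → Graph V} (e : J ↔ I) →
    IsDecomposition G H → IsDecomposition G (H ∘ to e)
  reindex {H = H} e (H⊑G , cover) = (λ j → H⊑G (to e j)) , λ g →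
    let i , h , unique = cover g in
    from e i ,
    subst (λ k → Adj (H k) _ _) (sym (strictlyInverseˡ e i)) h ,
    λ {j} h′ → trans (cong (from e) (unique h′)) (strictlyInverseʳ e j)

  -- An edge of `L i′ j′` is an edge of `H i′`, so uniqueness of the outer index gives `i ≡ i′`;
  -- only then can the inner indices be compared.
  refine : ∀ {I : Set} {J : I → Set} {H : I → Graph V} {L : ∀ i → J i → Graph V} →
    IsDecomposition G H → (∀ i → IsDecomposition (H i) (L i)) →
    IsDecomposition G λ ((i , j) : Σ I J) → L i j
  refine {L = L} (H⊑G , cover) D = (λ (i , j) l → H⊑G i (proj₁ (D i) j l)) , λ {a} {b} g →
    let i , h , unique-i = cover g
        j , l , unique-j = proj₂ (D i) h
        unique : ∀ {i′ j′} → i ≡ i′ → Adj (L i′ j′) a b → (i , j) ≡ (i′ , j′)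
        unique = λ { refl l′ → cong (i ,_) (unique-j l′) }
    in (i , j) , l , λ {(i′ , j′)} l′ → unique (unique-i (proj₁ (D i′) j′ l′)) l′

  -- All graphs here span `V`, so the condition on components does not involve the host graph.
  cycleFactor-⊑ : ∀ {m} {H F : Graph V} → H ⊑ G → IsCycleFactor m H F → IsCycleFactor m G F
  cycleFactor-⊑ H⊑G (F⊑H , C) = H⊑G ∘ F⊑H , C

  refine-cycleFactors : ∀ {c m n} {H : Fin c → Graph V} {r s : Fin c → ℕ} →
    IsDecomposition G H → (∀ q → CycleFactorDecomposition (H q) m n (r q) (s q)) →
    CycleFactorDecomposition G m n (sum r) (sum s)
  refine-cycleFactors {H = H} {r} {s} D E = record
    { factor          = (λ (q , i) → factor (E q) i) ∘ to e
    ; isDecomposition =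
        reindex {H = λ (q , i) → factor (E q) i} e
          (refine {H = H} {L = factor ∘ E} D (isDecomposition ∘ E))
    ; isCₘ-factor     = λ i → let q , j = to (Fin-sum r) i in
                        cycleFactor-⊑ {H = H q} (proj₁ D q) (isCₘ-factor (E q) j)
    ; isCₙ-factor     = λ i → let q , j = to (Fin-sum s) i in
                        cycleFactor-⊑ {H = H q} (proj₁ D q) (isCₙ-factor (E q) j)
    }
    where
    open CycleFactorDecomposition
    -- This regrouping keeps the `inj₁` and `inj₂` sides apart by computation, so each factor keeps
    -- its cycle length.
    e = Σ-⊎ ↔-∘ (Fin-sum r ⊎-↔ Fin-sum s)

-- Gluing along the groups and the parallel classes

-- A resolvable group divisible design: T₀ is the tiling by the groups and T P the
-- tiling by the blocks of the parallel class P.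
module ResolvableTilings
  {X B : Set} {h k u c : ℕ} (T₀ : Tiling X (Fin u) (Fin h)) (T : Fin c → Tiling X B (Fin k))
  (transversal : ∀ {P a b} → tile T₀ a ≡ tile T₀ b → tile (T P) a ≡ tile (T P) b → a ≡ b)
  (joined : ∀ {a b} → tile T₀ a ≢ tile T₀ b → ∃! _≡_ λ P → tile (T P) a ≡ tile (T P) b)
  where

  module _ {V : Set} {x : ℕ} (e : V ↔ (X × Fin x)) where

    groups : Tiling V (Fin u) (Fin (h * x))
    groups = inflate e (↔-sym *↔×) T₀

    blocks : Fin c → Tiling V B (Fin k × Fin x)
    blocks P = inflate e (↔-id _) (T P)

    -- A common form for the complete graph and for the complete graph minus a matching inside the
    -- groups, so that one decomposition serves both parities.
    Joined : Graph (Fin (h * x)) → V → V → Set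
    Joined G₀ a b = tile groups a ≢ tile groups b ⊎ Adj (copies groups G₀) a b

    -- On a block tile, the parts of the multipartite graph are the fibres over the `k` points of
    -- the block.
    pieces : Graph (Fin (h * x)) → Fin (suc c) → Graph V
    pieces G₀ zero    = copies groups G₀
    pieces G₀ (suc P) = copies (blocks P) (completeMultipartite x k)

    pieces-decomposition : ∀ {G G₀} →
      (∀ {a b} → Adj G a b ⇔ Joined G₀ a b) →
      IsDecomposition G (pieces G₀)
    pieces-decomposition {G} {G₀} G⇔ = piece-⊑ , cover ∘ Equivalence.to G⇔
      where
      -- Vertices sharing both group and block lie over one point, hence in one part.
      not-both : ∀ {P a b} → tile groups a ≡ tile groups b →
        ¬ Adj (copies (blocks P) (completeMultipartite x k)) a b
      not-both {P} p (q , c≢) = c≢ (cong (coord (T P)) (transversal p q))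

      piece-⊑ : ∀ q → pieces G₀ q ⊑ G
      piece-⊑ zero    g = Equivalence.from G⇔ (inj₂ g)
      piece-⊑ (suc P) g = Equivalence.from G⇔ (inj₁ λ p → not-both p g)

      cover : ∀ {a b} → Joined G₀ a b → ∃! _≡_ λ q → Adj (pieces G₀ q) a b
      cover (inj₁ p≢) = let P , q , unique = joined p≢ in
        suc P ,
        -- Equal parts would put both vertices over one point, hence in one group.
        (q , λ c≡ → p≢ (cong (tile T₀) (separated (T P) q c≡))) ,
        λ { {zero} (p , _) → contradiction p p≢ ; {suc P′} (q′ , _) → cong suc (unique q′) }
      cover (inj₂ g) =
        zero , g , λ { {zero} _ → refl ; {suc P} g′ → contradiction g′ (not-both (proj₁ g)) }

    glue : ∀ {G G₀ m n rβ sβ} {r s : Fin c → ℕ} →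
      (∀ {a b} → Adj G a b ⇔ Joined G₀ a b) →
      (∀ P → CycleFactorDecomposition (completeMultipartite x k) m n (r P) (s P)) →
      CycleFactorDecomposition G₀ m n rβ sβ →
      CycleFactorDecomposition G m n (sum r + rβ) (sum s + sβ)
    glue {G} {G₀} {m} {n} {rβ} {sβ} {r} {s} G⇔ E D =
      -- The groups are piece `zero`, so their share comes first in the sums.
      subst₂ (CycleFactorDecomposition G m n) (+-comm rβ (sum r)) (+-comm sβ (sum s))
        (refine-cycleFactors {H = pieces G₀} {r = rβ Vector.∷ r} {s = sβ Vector.∷ s}
          (pieces-decomposition {G} G⇔)
          λ { zero → copies-decomposition groups D
            ; (suc P) → copies-decomposition (blocks P) (E P) })

    ≢⇔ : ∀ {a b} → a ≢ b ⇔ Joined (complete (h * x)) a b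
    ≢⇔ {a} {b} = mk⇔ split λ { (inj₁ p≢) → p≢ ∘ cong (tile groups)
                             ; (inj₂ (_ , c≢)) → c≢ ∘ cong (coord groups) }
      where
      split : a ≢ b → Joined (complete (h * x)) a b
      split a≢b with tile groups a ≟ tile groups b
      ... | yes p = inj₂ (p , a≢b ∘ separated groups p)
      ... | no p≢ = inj₁ p≢

    -- The copies of `F` have no edges between groups, so removing them changes only the graph
    -- inside each group.
    ≢−⇔ : ∀ F {a b} →
      (a ≢ b × ¬ Adj (copies groups F) a b) ⇔ Joined (complete (h * x) − F) a b
    ≢−⇔ F {a} {b} = mk⇔
      (λ (a≢b , ¬f) → remove ¬f (Equivalence.to ≢⇔ a≢b))
      (λ { (inj₁ p≢) → Equivalence.from ≢⇔ (inj₁ p≢) , p≢ ∘ proj₁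
         ; (inj₂ (p , c≢ , ¬f)) → Equivalence.from ≢⇔ (inj₂ (p , c≢)) , ¬f ∘ proj₂ })
      where
      remove : ¬ Adj (copies groups F) a b →
        Joined (complete (h * x)) a b → Joined (complete (h * x) − F) a b
      remove ¬f (inj₁ p≢)       = inj₁ p≢
      remove ¬f (inj₂ (p , c≢)) = inj₂ (p , c≢ , λ f → ¬f (p , f))

-- Counting the points as seen from one of them

count : ∀ {v h k u c} {B : Set}
  (T₀ : Tiling (Fin v) (Fin u) (Fin h)) (T : Fin c → Tiling (Fin v) B (Fin (suc k))) →
  (∀ {P a b} → tile T₀ a ≡ tile T₀ b → tile (T P) a ≡ tile (T P) b → a ≡ b) →
  (∀ {a b} → tile T₀ a ≢ tile T₀ b → ∃! _≡_ λ P → tile (T P) a ≡ tile (T P) b) →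
  Fin v → h + c * k ≡ v
count {v} {h} {k} {c = c} T₀ T transversal joined a =
  -- The second inverse law follows from the first by injectivity of `f`.
  ↔⇒≡ (mk↔ₛ′ f g f-g (λ i → f-injective (f-g (f i))) ↔-∘ ((↔-id _ ⊎-↔ *↔×) ↔-∘ +↔⊎))
  where
  -- First the group of `a`, with `a` included; then, for each class, the `k` other points of the
  -- block through `a`, where `punchIn` skips `a` itself.
  f : Fin h ⊎ (Fin c × Fin k) → Fin v
  f (inj₁ i)       = point T₀ a i
  f (inj₂ (P , j)) = point (T P) a (punchIn (coord (T P) a) j)

  other-group : ∀ P j → tile T₀ a ≢ tile T₀ (f (inj₂ (P , j)))
  -- Sharing the group as well as the block would make this point equal to `a`, whose coordinate
  -- `punchIn` avoids.
  other-group P j p = punchInᵢ≢i (coord (T P) a) j (sym (trans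
    (cong (coord (T P)) (transversal p (sym (tile-point (T P) a _)))) (coord-point (T P) a _)))

  f-injective : Injective _≡_ _≡_ f
  f-injective {inj₁ i} {inj₁ i′} eq = cong inj₁
    (trans (sym (coord-point T₀ a i)) (trans (cong (coord T₀) eq) (coord-point T₀ a i′)))
  f-injective {inj₁ i} {inj₂ (P , j)} eq =
    contradiction (trans (sym (tile-point T₀ a i)) (cong (tile T₀) eq)) (other-group P j)
  f-injective {inj₂ (P , j)} {inj₁ i} eq =
    contradiction (trans (sym (tile-point T₀ a i)) (cong (tile T₀) (sym eq))) (other-group P j)
  f-injective {inj₂ (P , j)} {inj₂ (P′ , j′)} eq = same-class P≡P′ eq
    where
    P≡P′ : P ≡ P′
    -- Both classes join `a` to the same point outside its group.
    P≡P′ = let _ , _ , unique = joined (other-group P j) in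
      trans (sym (unique (sym (tile-point (T P) a _))))
            (unique (trans (sym (tile-point (T P′) a _)) (cong (tile (T P′)) (sym eq))))

    same-class : ∀ {P′} → P ≡ P′ → f (inj₂ (P , j)) ≡ f (inj₂ (P′ , j′)) →
      inj₂ (P , j) ≡ inj₂ (P′ , j′)
    same-class refl eq = cong (λ j → inj₂ (P , j)) (punchIn-injective (coord (T P) a) j j′
      (trans (sym (coord-point (T P) a _)) (trans (cong (coord (T P)) eq) (coord-point (T P) a _))))

  preimage : ∀ b → ∃ λ i → f i ≡ b
  preimage b with tile T₀ a ≟ tile T₀ b
  ... | yes p = inj₁ (coord T₀ b) , point-coord T₀ p
  ... | no p≢ =
    let P , q , _ = joined p≢
        c≢ = λ c≡ → p≢ (cong (tile T₀) (separated (T P) q c≡))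
    in inj₂ (P , punchOut c≢) ,
       trans (cong (point (T P) a) (punchIn-punchOut c≢)) (point-coord (T P) q)

  g   = proj₁ ∘ preimage
  f-g = proj₂ ∘ preimage

-- The tilings of a 3-RGDD

module Design {h u : ℕ} (R : 3-RGDD h u) where
  open 3-RGDD R

  groupOf : Fin (h * u) → Fin u
  groupOf a = proj₁ (group-partition a)

  ∈groupOf : ∀ a → a ∈ group (groupOf a)
  ∈groupOf a = proj₁ (proj₂ (group-partition a))

  groupTiling : Tiling (Fin (h * u)) (Fin u) (Fin h)
  groupTiling = subsetTiling group group-size groupOf ∈groupOf
    λ {a} {b} → proj₂ (proj₂ (group-partition b))

  blockOf : Fin #classes → Fin (h * u) → Fin #blocks
  blockOf P a = proj₁ (parallel P a)

  ∈blockOf : ∀ P a → a ∈ block (blockOf P a)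
  ∈blockOf P a = proj₂ (proj₁ (proj₂ (parallel P a)))

  class-blockOf : ∀ P a → class (blockOf P a) ≡ P
  class-blockOf P a = proj₁ (proj₁ (proj₂ (parallel P a)))

  blockOf-unique : ∀ {P a B} → class B ≡ P → a ∈ block B → blockOf P a ≡ B
  blockOf-unique {P} {a} p a∈B = proj₂ (proj₂ (parallel P a)) (p , a∈B)

  classTiling : Fin #classes → Tiling (Fin (h * u)) (Fin #blocks) (Fin 3)
  classTiling P = subsetTiling block block-size (blockOf P) (∈blockOf P)
    λ {a} → blockOf-unique (class-blockOf P a)

  transversal : ∀ {P a b} → groupOf a ≡ groupOf b → blockOf P a ≡ blockOf P b → a ≡ b
  transversal {P} {a} {b} p q with a ≟ b
  ... | yes a≡b = a≡b
  ... | no a≢b  = contradiction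
    (∈blockOf P a , subst (λ B → b ∈ block B) (sym q) (∈blockOf P b))
    (same-group a≢b (∈groupOf a) (subst (λ g → b ∈ group g) (sym p) (∈groupOf b)) _)

  -- The class is that of the one block through both points. In any class where their blocks
  -- coincide, the common block must be this one.
  joined : ∀ {a b} → groupOf a ≢ groupOf b → ∃! _≡_ λ P → blockOf P a ≡ blockOf P b
  joined {a} {b} p≢ =
    let B , (a∈B , b∈B) , unique = different-group p≢ (∈groupOf a) (∈groupOf b) in
    class B ,
    trans (blockOf-unique refl a∈B) (sym (blockOf-unique refl b∈B)) ,
    λ {P} q → trans
      (cong class (unique (∈blockOf P a , subst (λ B → b ∈ block B) (sym q) (∈blockOf P b))))
      (class-blockOf P a)

  points : Fin (h * u) → h + #classes * 2 ≡ h * u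
  points = count groupTiling classTiling transversal joined

  open ResolvableTilings groupTiling classTiling transversal joined public

-- Number of classes and parity

class-count : ∀ {h c} u → h + c * 2 ≡ h * u → c ≡ h * (u ∸ 1) / 2
class-count {h} {c} u eq = begin
  c                       ≡⟨ m*n/n≡m c 2 ⟨
  c * 2 / 2               ≡⟨ cong (_/ 2) (m+n∸m≡n h (c * 2)) ⟨
  (h + c * 2 ∸ h) / 2     ≡⟨ cong (λ v → (v ∸ h) / 2) eq ⟩
  (h * u ∸ h) / 2         ≡⟨ cong (λ w → (h * u ∸ w) / 2) (*-identityʳ h) ⟨
  (h * u ∸ h * 1) / 2     ≡⟨ cong (_/ 2) (*-distribˡ-∸ h u 1) ⟨
  h * (u ∸ 1) / 2         ∎
  where open ≡-Reasoning

-- The two products differ by the even number `c * 2 * x`.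
same-parity : ∀ {h c v} x → h + c * 2 ≡ v → (2 ∣ h * x) ⇔ (2 ∣ v * x)
same-parity {h} {c} x refl = mk⇔
  (λ d → subst (2 ∣_) (sym expand) (∣m∣n⇒∣m+n d even))
  (λ d → ∣m+n∣m⇒∣n (subst (2 ∣_) (trans expand (+-comm (h * x) _)) d) even)
  where
  expand : (h + c * 2) * x ≡ h * x + c * 2 * x
  expand = *-distribʳ-+ x h (c * 2)
  even : 2 ∣ c * 2 * x
  even = ∣m⇒∣m*n x (n∣m*n c)

lemma14 : (m n x h u : ℕ) → 3 ≤ m → 3 ≤ n → 1 ≤ x → m ∣ 3 * x → n ∣ 3 * x →
    1 ≤ h → 1 ≤ u →
    3-RGDD h u →
    (r s : Fin (h * (u ∸ 1) / 2) → ℕ) →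
    (∀ p → CycleFactorDecomposition (completeMultipartite x 3) m n (r p) (s p)) →
    (rβ sβ : ℕ) →
    HWP m n (h * x) rβ sβ →
    HWP m n (h * u * x) (sum r + rβ) (sum s + sβ)
lemma14 m n x h@(suc _) u@(suc _) _ _ _ _ _ _ _ R r s E rβ sβ =
  construct (class-count u size) r s E
  where
  open 3-RGDD R using (#classes)
  open Design R

  size : h + #classes * 2 ≡ h * u
  -- As `h` and `u` are successors, so is `h * u`, which provides the point `0F` to count from.
  size = points 0F

  parity : (2 ∣ h * x) ⇔ (2 ∣ h * u * x)
  parity = same-parity {h} {#classes} x size

  -- The design has `#classes` classes, while `r` and `s` are indexed by the closed formula.
  -- Generalising the formula to `c` lets `refl` identify the two without transport.
  construct : ∀ {c} → #classes ≡ c → (r s : Fin c → ℕ) →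
    (∀ P → CycleFactorDecomposition (completeMultipartite x 3) m n (r P) (s P)) →
    HWP m n (h * x) rβ sβ → HWP m n (h * u * x) (sum r + rβ) (sum s + sβ)
  -- Here `*↔×` splits a vertex into a point of the design and one of its `x` copies.
  construct refl r s E (inj₁ (odd , D)) =
    inj₁ (odd ∘ Equivalence.from parity , glue *↔× {G = complete _} (≢⇔ *↔×) E D)
  construct refl r s E (inj₂ (even , F , F-factor , D)) =
    inj₂ (Equivalence.to parity even , copies (groups *↔×) F ,
          ((λ { f refl → irrefl (copies (groups *↔×) F) f }) ,
           copies-matching (groups *↔×) F (proj₂ F-factor)) ,
          glue *↔× {G = complete _ − copies (groups *↔×) F} (≢−⇔ *↔× F) E D)
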